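{- Let $\mathcal{C}^u_f$ be the class of $\mathsf{TUS}$-frames and $\mathcal{C}^d_f$ the class of $\mathsf{TDS}$-frames. For every $\phi\in\mathcal{L}_{\mathsf{TDS}}$: $\mathcal{C}^u_f\models\phi$ implies $\mathcal{C}^d_f\models\phi$.
   Context: **Language.** Let $Ag=\{1,2,\dots,n\}$ be a finite set of agent labels and $Var=\{p_1,p_2,p_3,\dots\}$ a countable set of propositional variables. $\mathcal{L}_{\mathsf{TDS}}$ is given by $\phi ::= p \mid \neg\phi \mid \phi\land\phi \mid \Box\phi \mid [i]\phi \mid [Ag]\phi \mid \mathsf{G}\phi \mid \mathsf{H}\phi \mid \otimes_i\phi$ with $i\in Ag$, $p\in Var$. **Common conditions.** For binary relations on a non-empty set $W$, write $R(w)=\{v\in W:(w,v)\in R\}$. Consider: - $R_\Box$, all $R_{[i]}$ ($i\in Ag$), and $R_{[Ag]}$ are equivalence relations, and for all $i\in Ag$: (C1) $R_{[i]}\subseteq R_\Box$; (C2) for all $u_1,\dots,u_n\in W$, if $R_\Box u_iu_j$ for all $1\le i,j\le n$, then $\bigcap_{i}R_{[i]}(u_i)\neq\emptyset$; (C3) for all $w$, $R_{[Ag]}(w)\subseteq\bigcap_{i\in Ag}R_{[i]}(w)$. - $R_{\mathsf G}$ is transitive and serial, $R_{\mathsf H}$ is the converse of $R_{\mathsf G}$, and: (T4) if $R_{\mathsf G}wu$ and $R_{\mathsf G}wv$ then $R_{\mathsf G}uv$, $u=v$, or $R_{\mathsf G}vu$; (T5) if $R_{\mathsf H}wu$ and $R_{\mathsf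 H}wv$ then $R_{\mathsf H}uv$, $u=v$, or $R_{\mathsf H}vu$; (T6) $R_{\mathsf G}\circ R_\Box\subseteq R_{[Ag]}\circ R_{\mathsf G}$, i.e. if $R_{\mathsf G}wu$ and $R_\Box uv$ then there is $x$ with $R_{[Ag]}wx$ and $R_{\mathsf G}xv$; (T7) if $u\in R_\Box(w)$ then $u\notin R_{\mathsf G}(w)$. **$\mathsf{TDS}$-frames.** A $\mathsf{TDS}$-frame is $(W,R_\Box,\{R_{[i]}\}_{i\in Ag},R_{[Ag]},R_{\mathsf G},R_{\mathsf H},\{R_{\otimes_i}\}_{i\in Ag})$ satisfying the common conditions and, for all $i\in Ag$: (D8) $R_{\otimes_i}\subseteq R_\Box$; (D9) for all $w$ there is $v$ with $R_\Box wv$ such that for all $u$, $R_{[i]}vu$ implies $R_{\otimes_i}wu$; (D10) for all $w,v,u,z$, if $R_\Box wv$, $R_\Box wu$ and $R_{\otimes_i}uz$, then $R_{\otimes_i}vz$; (D11) for all $w,v$, if $R_{\otimes_i}wv$ then there is $u$ with $R_\Box wu$, $R_{[i]}uv$, and for all $z$, $R_{[i]}uz$ implies $R_{\otimes_i}wz$. **$\mathsf{TUS}$-frames.** A $\mathsf{TUS}$-frame is $(W,R_\Box,\{R_{[i]}\}_{i\in Ag},R_{[Ag]},R_{\mathsf G},R_{\mathsf H},util)$ satisfying the common conditions, with $util:W\to\mathbb{N}$ any function. **Models and satisfaction.** A model is a frame with a valuation $V:Var\to\mathcal{P}(W)$. In both kinds of models, $M,w\models p$ iff $w\in V(p)$,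 Boolean clauses are as usual, and $\Box,[i],[Ag],\mathsf G,\mathsf H$ are the universal modalities of $R_\Box,R_{[i]},R_{[Ag]},R_{\mathsf G},R_{\mathsf H}$. In $\mathsf{TDS}$-models, $M,w\models\otimes_i\phi$ iff $M,u\models\phi$ for all $u\in R_{\otimes_i}(w)$. In $\mathsf{TUS}$-models the clause for $\otimes_i$ uses the following. - State for $i$ at $v$: $R^s_{[i]}(v)=\bigcap_{k\in Ag\setminus\{i\}}R_{[k]}(v)$ (if $Ag=\{i\}$, this is read as $R_\Box(v)$). - For $X,Y\subseteq R_\Box(w)$: $X\le Y$ iff $util(x)\le util(y)$ for all $x\in X,y\in Y$. - For $R_{[i]}(v),R_{[i]}(z)\subseteq R_\Box(w)$: $R_{[i]}(v)\preceq R_{[i]}(z)$ iff for all $R^s_{[i]}(x)\subseteq R_\Box(w)$, $R_{[i]}(v)\cap R^s_{[i]}(x)\le R_{[i]}(z)\cap R^s_{[i]}(x)$; and $R_{[i]}(v)\prec R_{[i]}(z)$ iff $R_{[i]}(v)\preceq R_{[i]}(z)$ and $R_{[i]}(z)\not\preceq R_{[i]}(v)$. With $\|\phi\|=\{w: M,w\models\phi\}$: $M,w\models\otimes_i\phi$ iff for every $R_{[i]}(v)\subseteq R_\Box(w)$ with $R_{[i]}(v)\not\subseteq\|\phi\|$ there is $R_{[i]}(z)\subseteq R_\Box(w)$ such that (i) $R_{[i]}(v)\prec R_{[i]}(z)$, (ii) $R_{[i]}(z)\subseteq\|\phi\|$, and (iii) for all $R_{[i]}(x)\subseteq R_\Box(w)$,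 $R_{[i]}(z)\preceq R_{[i]}(x)$ implies $R_{[i]}(x)\subseteq\|\phi\|$. **Validity.** For a class $\mathcal C$ of frames, $\mathcal C\models\phi$ means $M,w\models\phi$ for every model $M$ based on a frame in $\mathcal C$ and every world $w$ of $M$. -}

module Defs where

open import Data.Fin using (Fin)
open import Data.Nat using (ℕ; _≤_)
open import Data.Product using (∃; ∃-syntax; _×_; _,_)
open import Data.Sum using (_⊎_)
open import Function using (flip)
open import Level using (Level; suc)
open import Relation.Binary.Core using (Rel; _⇒_; _⇔_)
open import Relation.Binary.Definitions using (Transitive)
open import Relation.Binary.PropositionalEquality using (_≡_; _≢_)
open import Relation.Binary.Structures using (IsEquivalence)
open import Relation.Nullary using (¬_)
open import Relation.Unary using (Pred; _∈_; _⊆_; _∩_; ∁; ⋂; Satisfiable)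

infixr 6 _∧_
infix 7 ∼_ □_ [_]_ [Ag]_ G_ H_ ⊗[_]_

data Formula (n : ℕ) : Set where
  var    : ℕ → Formula n
  ∼_     : Formula n → Formula n
  _∧_    : Formula n → Formula n → Formula n
  □_     : Formula n → Formula n
  [_]_   : Fin n → Formula n → Formula n
  [Ag]_  : Formula n → Formula n
  G_     : Formula n → Formula n
  H_     : Formula n → Formula n
  ⊗[_]_  : Fin n → Formula n → Formula n

record TemporalFrame (n : ℕ) (ℓ : Level) : Set (suc ℓ) where
  field
    W     : Set ℓ
    world : W
    R□    : Rel W ℓ
    R[_]  : Fin n → Rel W ℓ
    R[Ag] : Rel W ℓ
    RG    : Rel W ℓ
    RH    : Rel W ℓ

    □-equiv  : IsEquivalence R□
    []-equiv : ∀ i → IsEquivalence R[ i ]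
    Ag-equiv : IsEquivalence R[Ag]

    C1 : ∀ i → R[ i ] ⇒ R□
    C2 : ∀ (u : Fin n → W) → (∀ i j → R□ (u i) (u j)) →
         Satisfiable (⋂ (Fin n) λ i → R[ i ] (u i))
    C3 : ∀ w → R[Ag] w ⊆ ⋂ (Fin n) λ i → R[ i ] w

    G-trans    : Transitive RG
    G-serial   : ∀ w → Satisfiable (RG w)
    H-converse : RH ⇔ flip RG

    T4 : ∀ w u v → RG w u → RG w v → RG u v ⊎ u ≡ v ⊎ RG v u
    T5 : ∀ w u v → RH w u → RH w v → RH u v ⊎ u ≡ v ⊎ RH v u
    T6 : ∀ w u v → RG w u → R□ u v → ∃[ x ] R[Ag] w x × RG x v
    T7 : ∀ w u → u ∈ R□ w → ¬ (u ∈ RG w)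

record TDSFrame (n : ℕ) (ℓ : Level) : Set (suc ℓ) where
  field
    temporal : TemporalFrame n ℓ
  open TemporalFrame temporal public
  field
    R⊗[_] : Fin n → Rel W ℓ

    D8  : ∀ i → R⊗[ i ] ⇒ R□
    D9  : ∀ i w → ∃[ v ] R□ w v × (∀ u → R[ i ] v u → R⊗[ i ] w u)
    D10 : ∀ i w v u z → R□ w v → R□ w u → R⊗[ i ] u z → R⊗[ i ] v z
    D11 : ∀ i w v → R⊗[ i ] w v →
          ∃[ u ] R□ w u × R[ i ] u v × (∀ z → R[ i ] u z → R⊗[ i ] w z)

record TUSFrame (n : ℕ) (ℓ : Level) : Set (suc ℓ) where
  field
    temporal : TemporalFrame n ℓ
  open TemporalFrame temporal public
  field
    util : W → ℕ

[_]ᵁ : ∀ {ℓ} {W : Set ℓ} → Rel W ℓ → Pred W ℓ → Pred W ℓ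
[ R ]ᵁ X w = R w ⊆ X

-- The two semantics differ only in how ⊗ᵢ acts on truth sets, so that
-- action is a parameter here.
module Satisfaction {n : ℕ} {ℓ : Level} (F : TemporalFrame n ℓ)
  (ought : Fin n → Pred (TemporalFrame.W F) ℓ → Pred (TemporalFrame.W F) ℓ)
  (V : ℕ → Pred (TemporalFrame.W F) ℓ) where

  open TemporalFrame F

  ‖_‖ : Formula n → Pred W ℓ
  ‖ var p ‖    = V p
  ‖ ∼ φ ‖      = ∁ ‖ φ ‖
  ‖ φ ∧ ψ ‖    = ‖ φ ‖ ∩ ‖ ψ ‖
  ‖ □ φ ‖      = [ R□ ]ᵁ ‖ φ ‖
  ‖ [ i ] φ ‖  = [ R[ i ] ]ᵁ ‖ φ ‖
  ‖ [Ag] φ ‖   = [ R[Ag] ]ᵁ ‖ φ ‖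
  ‖ G φ ‖      = [ RG ]ᵁ ‖ φ ‖
  ‖ H φ ‖      = [ RH ]ᵁ ‖ φ ‖
  ‖ ⊗[ i ] φ ‖ = ought i ‖ φ ‖

module TDS {n : ℕ} {ℓ : Level} (F : TDSFrame n ℓ) where
  open TDSFrame F

  ought : Fin n → Pred W ℓ → Pred W ℓ
  ought i = [ R⊗[ i ] ]ᵁ

  open Satisfaction temporal ought public

module TUS {n : ℕ} {ℓ : Level} (F : TUSFrame n ℓ) where
  open TUSFrame F

  -- The second factor takes effect only when i is the sole agent: the
  -- intersection is then empty and the state is R□ v by convention.
  State : Fin n → W → Pred W ℓ
  State i v = (⋂ (∃[ k ] k ≢ i) λ (k , _) → R[ k ] v)
            ∩ (λ u → (∀ k → k ≡ i) → R□ v u)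

  _≤ᵁ_ : Pred W ℓ → Pred W ℓ → Set ℓ
  X ≤ᵁ Y = ∀ x y → x ∈ X → y ∈ Y → util x ≤ util y

  -- The choices R[ i ] v and R[ i ] z are compared through their
  -- representatives v and z, relative to the moment R□ w.
  Weak Strict : W → Fin n → Rel W ℓ
  Weak w i v z = ∀ x → State i x ⊆ R□ w →
                 (R[ i ] v ∩ State i x) ≤ᵁ (R[ i ] z ∩ State i x)
  Strict w i v z = Weak w i v z × ¬ Weak w i z v

  ought : Fin n → Pred W ℓ → Pred W ℓ
  ought i X w =
    ∀ v → R[ i ] v ⊆ R□ w → ¬ (R[ i ] v ⊆ X) →
    ∃[ z ] R[ i ] z ⊆ R□ w
         × Strict w i v z
         × R[ i ] z ⊆ X
         × (∀ x → R[ i ] x ⊆ R□ w → Weak w i z x → R[ i ] x ⊆ X)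

  open Satisfaction temporal ought public

TDS-Valid : ∀ {n} (ℓ : Level) → Formula n → Set (suc ℓ)
TDS-Valid {n} ℓ φ =
  (F : TDSFrame n ℓ) (V : ℕ → Pred (TDSFrame.W F) ℓ) (w : TDSFrame.W F) →
  w ∈ TDS.‖_‖ F V φ

TUS-Valid : ∀ {n} (ℓ : Level) → Formula n → Set (suc ℓ)
TUS-Valid {n} ℓ φ =
  (F : TUSFrame n ℓ) (V : ℕ → Pred (TUSFrame.W F) ℓ) (w : TUSFrame.W F) →
  w ∈ TUS.‖_‖ F V φ

{-# OPTIONS --safe #-}
module Submission where

-- Every TDS-frame becomes a TUS-frame with the same temporal part and the same
-- truth sets once a world gets utility 1 when it is ideal for all agents
-- simultaneously and 0 otherwise. Whether a world is ideal for an agent depends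
-- only on that agent's choice there, so against fixed choices of the others an
-- ideal choice does at least as well as any other; it does strictly better than
-- a non-ideal one when the others all choose ideally. Hence the
-- undominated choices are exactly the ideal ones.

open import Defs
open import Axiom.ExcludedMiddle using (ExcludedMiddle)
open import Data.Fin using (Fin)
open import Data.Fin.Properties using (_≟_; all?; ¬∀⟶∃¬)
open import Data.Nat using (ℕ; _≤_; z≤n)
open import Data.Nat.Properties using (≤-refl)
open import Data.Product using (∃-syntax; _×_; _,_; proj₁; proj₂)
open import Data.Vec.Functional using (updateAt)
open import Data.Vec.Functional.Properties using (updateAt-updates; updateAt-minimal)
open import Function using (const; _∘_)
open import Level using (Level)
open import Relation.Binary.Core using (Rel)
open import Relation.Binary.PropositionalEquality using (_≢_; refl; subst)
open import Relation.Binary.Structures using (IsEquivalence)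
open import Relation.Nullary using (Dec; yes; no; contradiction)
open import Relation.Unary using (Pred; _∈_; _⊆_; _≐_)

indicator : ∀ {p} {P : Set p} → Dec P → ℕ
indicator (yes _) = 1
indicator (no  _) = 0

module _ {p q} {P : Set p} {Q : Set q} where

  indicator-mono : (P? : Dec P) (Q? : Dec Q) → (P → Q) → indicator P? ≤ indicator Q?
  indicator-mono (yes p) (yes _) _ = ≤-refl
  indicator-mono (yes p) (no ¬q) f = contradiction (f p) ¬q
  indicator-mono (no  _) _       _ = z≤n

  indicator-reflects : (P? : Dec P) (Q? : Dec Q) → indicator P? ≤ indicator Q? → P → Q
  indicator-reflects (yes _) (yes q) _  _ = q
  indicator-reflects (yes _) (no  _) () _
  indicator-reflects (no ¬p) _       _  p = contradiction p ¬p

[]ᵁ-cong : ∀ {ℓ} {W : Set ℓ} (R : Rel W ℓ) {X Y : Pred W ℓ} → X ≐ Y → [ R ]ᵁ X ≐ [ R ]ᵁ Y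
[]ᵁ-cong R (X⊆Y , Y⊆X) = (λ R⊆X r → X⊆Y (R⊆X r)) , (λ R⊆Y r → Y⊆X (R⊆Y r))

module Temporal {n ℓ} (F : TemporalFrame n ℓ) where
  open TemporalFrame F

  open IsEquivalence □-equiv public
    using () renaming (refl to □-refl; sym to □-sym; trans to □-trans)
  module Choice i = IsEquivalence ([]-equiv i)

  choice⊆moment : ∀ i {w v} → R□ w v → R[ i ] v ⊆ R□ w
  choice⊆moment i wv vu = □-trans wv (C1 i vu)

  -- `C2` applied to `u` with its `i`-th entry overwritten by `v`.
  independence : ∀ {w} i v (u : Fin n → W) → R□ w v → (∀ k → R□ w (u k)) →
                 ∃[ y ] R[ i ] v y × (∀ k → k ≢ i → R[ k ] (u k) y)
  independence {w} i v u wv wu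
    with C2 profile (λ j k → □-trans (□-sym (within j)) (within k))
    where
    profile : Fin n → W
    profile = updateAt u i (const v)
    within : ∀ k → R□ w (profile k)
    within k with k ≟ i
    ... | yes refl rewrite updateAt-updates i {const v} u = wv
    ... | no k≢i   rewrite updateAt-minimal k i {const v} u k≢i = wu k
  ... | y , yP = y
    , subst (λ t → R[ i ] t y) (updateAt-updates i u) (yP i)
    , λ k k≢i → subst (λ t → R[ k ] t y) (updateAt-minimal k i u k≢i) (yP k)

module Utilitarian {ℓ} (em : ExcludedMiddle ℓ) {n} (F : TDSFrame n ℓ) where
  open TDSFrame F
  open Temporal temporal

  -- By `D10` all worlds of a moment have the same `R⊗[ i ]`-successors, so being one of them
  -- depends on `v` alone and can be tested from `v` itself.
  Ideal : Fin n → Pred W ℓ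
  Ideal i v = R⊗[ i ] v v

  ⊗⇒ideal : ∀ {i w v} → R⊗[ i ] w v → Ideal i v
  ⊗⇒ideal {i} r = D10 i _ _ _ _ (D8 i r) □-refl r

  ideal⇒⊗ : ∀ {i w v} → R□ w v → Ideal i v → R⊗[ i ] w v
  ideal⇒⊗ {i} wv = D10 i _ _ _ _ (□-sym wv) □-refl

  -- `D11` puts `v` in a choice made up of `R⊗[ i ]`-successors only; as choices are equivalence
  -- classes, that choice is the one containing `u`.
  ideal-resp : ∀ {i v u} → R[ i ] v u → Ideal i v → Ideal i u
  ideal-resp {i} {v} vu v∈I with D11 i v v v∈I
  ... | t , _ , tv , t⊆⊗ = ⊗⇒ideal (t⊆⊗ _ (Choice.trans i tv vu))

  AllIdeal : Pred W ℓ
  AllIdeal v = ∀ i → Ideal i v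

  utilitarian : TUSFrame n ℓ
  utilitarian = record { temporal = temporal ; util = λ v → indicator (em {AllIdeal v}) }

  open TUS utilitarian using (State; Weak)

  -- If some agent differs from `i`, `C1` for that agent suffices; otherwise the sole-agent
  -- convention applies.
  state⊆moment : ∀ i {w x} → R□ w x → State i x ⊆ R□ w
  state⊆moment i wx (others , sole) with all? (_≟ i)
  ... | yes k≡i = □-trans wx (sole k≡i)
  ... | no ¬k≡i with ¬∀⟶∃¬ n _ (_≟ i) ¬k≡i
  ...   | k , k≢i = choice⊆moment k wx (others (k , k≢i))

  -- Two worlds in one state of `i` share the choices of all other agents, so ideality for those
  -- agents carries over from `x` to `y`; for `i` it comes from `z`.
  ideal⇒maximal : ∀ {w i v z} → Ideal i z → Weak w i v z
  ideal⇒maximal {i = i} {z = z} z∈I s _ x y (_ , xS , _) (zy , yS , _) =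
    indicator-mono em em y∈I
    where
    y∈I : AllIdeal x → AllIdeal y
    y∈I x∈I k with k ≟ i
    ... | yes refl = ideal-resp zy z∈I
    ... | no k≢i   =
      ideal-resp (Choice.trans k (Choice.sym k (xS (k , k≢i))) (yS (k , k≢i))) (x∈I k)

  ideal-upward : ∀ {w i z v} → R□ w z → R□ w v → Ideal i z → Weak w i z v → Ideal i v
  ideal-upward {w} {i} {z} {v} wz wv z∈I z≼v
    -- `x` has utility 1: `i` chooses as at `z`, and every other agent takes the ideal choice given
    -- by `D9`.
    with independence i z (λ k → proj₁ (D9 k w)) wz (λ k → proj₁ (proj₂ (D9 k w)))
  ... | x , zx , others
    -- `y` lies in the same state of `i` as `x`, but in the choice of `v`. Comparing the two in that
    -- state forces utility 1 on `y` as well.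
    with independence i v (const x) wv (const (choice⊆moment i wz zx))
  ... | y , vy , xy = ideal-resp (Choice.sym i vy) (y∈I i)
    where
    wx : R□ w x
    wx = choice⊆moment i wz zx
    x∈I : AllIdeal x
    x∈I k with k ≟ i
    ... | yes refl = ideal-resp zx z∈I
    ... | no k≢i   = ⊗⇒ideal (proj₂ (proj₂ (D9 k w)) x (others k k≢i))
    xSx : x ∈ State i x
    xSx = (λ (k , _) → Choice.refl k) , const □-refl
    ySx : y ∈ State i x
    ySx = (λ (k , k≢i) → xy k k≢i) , const (□-trans (□-sym wx) (choice⊆moment i wv vy))
    y∈I : AllIdeal y
    y∈I = indicator-reflects em em
      (z≼v x (state⊆moment i wx) x y (zx , xSx) (vy , ySx)) x∈I

  ought-agree : ∀ i X → TUS.ought utilitarian i X ≐ TDS.ought F i X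
  ought-agree i X = to , from
    where
    to : TUS.ought utilitarian i X ⊆ TDS.ought F i X
    to {w} ought {v} wv with em {v ∈ X}
    ... | yes v∈X = v∈X
    ... | no v∉X
      with ought v (choice⊆moment i (D8 i wv)) (λ v⊆X → v∉X (v⊆X (Choice.refl i)))
    -- No choice is strictly better than that of `v`, which is ideal.
    ...   | z , _ , (_ , z⋠v) , _ = contradiction (ideal⇒maximal (⊗⇒ideal wv)) z⋠v

    from : TDS.ought F i X ⊆ TUS.ought utilitarian i X
    from {w} ⊗⊆X v v⊆w v⊈X with D9 i w
    -- The ideal choice from `D9` answers every `v`. Anything weakly above it is ideal, hence inside
    -- `X`; this gives the last clause, and also strictness, since the choice of `v` is not inside
    -- `X`.
    ... | z , wz , z⊆⊗ =
      z , choice⊆moment i wz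
        , (ideal⇒maximal z∈I , λ z≼v → v⊈X (⊆X v⊆w (upward v⊆w z≼v)))
        , (λ zu → ⊗⊆X (z⊆⊗ _ zu))
        , λ x x⊆w z≼x → ⊆X x⊆w (upward x⊆w z≼x)
      where
      z∈I : Ideal i z
      z∈I = ⊗⇒ideal (z⊆⊗ z (Choice.refl i))
      upward : ∀ {x} → R[ i ] x ⊆ R□ w → Weak w i z x → Ideal i x
      upward x⊆w = ideal-upward wz (x⊆w (Choice.refl i)) z∈I
      ⊆X : ∀ {x} → R[ i ] x ⊆ R□ w → Ideal i x → R[ i ] x ⊆ X
      ⊆X x⊆w x∈I xu = ⊗⊆X (ideal⇒⊗ (x⊆w xu) (ideal-resp xu x∈I))

  module _ (V : ℕ → Pred W ℓ) where

    truth-sets-agree : ∀ φ → TUS.‖_‖ utilitarian V φ ≐ TDS.‖_‖ F V φ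
    truth-sets-agree (var p)    = (λ v → v) , (λ v → v)
    truth-sets-agree (∼ φ) with truth-sets-agree φ
    ... | to , from = (λ ¬φ → ¬φ ∘ from) , (λ ¬φ → ¬φ ∘ to)
    truth-sets-agree (φ ∧ ψ) with truth-sets-agree φ | truth-sets-agree ψ
    ... | to , from | to′ , from′ =
      (λ (x , y) → to x , to′ y) , (λ (x , y) → from x , from′ y)
    truth-sets-agree (□ φ)      = []ᵁ-cong R□ (truth-sets-agree φ)
    truth-sets-agree ([ i ] φ)  = []ᵁ-cong R[ i ] (truth-sets-agree φ)
    truth-sets-agree ([Ag] φ)   = []ᵁ-cong R[Ag] (truth-sets-agree φ)
    truth-sets-agree (G φ)      = []ᵁ-cong RG (truth-sets-agree φ)
    truth-sets-agree (H φ)      = []ᵁ-cong RH (truth-sets-agree φ)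
    truth-sets-agree (⊗[ i ] φ)
      -- Passing to `R⊗[ i ]` before changing the truth set lets the inductive hypothesis act
      -- through an ordinary box.
      with ought-agree i (TUS.‖_‖ utilitarian V φ) | []ᵁ-cong R⊗[ i ] (truth-sets-agree φ)
    ... | to , from | to′ , from′ = (λ x → to′ (to x)) , (λ x → from (from′ x))

theorem4 : (ℓ : Level) → ExcludedMiddle ℓ →
    (n : ℕ) (φ : Formula n) → TUS-Valid ℓ φ → TDS-Valid ℓ φ
theorem4 ℓ em n φ valid F V w = proj₁ (truth-sets-agree V φ) (valid utilitarian V w)
  where open Utilitarian em F
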